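{- Let $F$ be a fullerene graph different from $F_{20}$ and $F_{24}$. If $F$ contains $R_5$ or $R_6$ as a subgraph, then $F$ is not 2-resonant.
   Context: A fullerene graph is a 3-connected plane cubic graph with exactly 12 pentagonal faces and all other faces hexagonal. $F_{20}$ is the dodecahedron. $F_{24}$ is the (unique) fullerene graph on 24 vertices: it has two hexagonal faces, each surrounded by a ring of six pentagons. $R_5$ is the graph obtained from $F_{20}$ by deleting the vertices of one pentagonal face (a central pentagon together with the five pentagons adjacent to it). $R_6$ is the graph obtained from $F_{24}$ by deleting the vertices of one hexagonal face (a central hexagon together with the ring of six pentagons around it). A set $\mathcal H$ of pairwise vertex-disjoint hexagonal faces is a resonant pattern if the graph has a perfect matching $M$ such that every hexagon in $\mathcal H$ is $M$-alternating (edges alternately in and off $M$). A fullerene graph is $k$-resonant if every set of $i$ pairwise disjoint hexagons, for each $0\le i\le k$, is a resonant pattern. -}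

module Defs where

open import Data.Nat using (ℕ; zero; suc; _+_; _*_; _≤_; _<_; _%_)
open import Data.Fin using (Fin; toℕ)
import Data.Fin as F
open import Data.Product using (Σ; ∃; _×_; _,_; proj₁; proj₂)
open import Data.Sum using (_⊎_)
open import Data.List using (List; map; concatMap; upTo; length)
open import Data.List.Membership.Propositional using (_∈_)
open import Data.List.Relation.Unary.All using (All)
open import Data.List.Relation.Unary.AllPairs using (AllPairs)
open import Relation.Binary.PropositionalEquality using (_≡_; _≢_)
open import Relation.Nullary using (¬_)
open import Data.Empty using (⊥)

-- Embedded (plane) cubic graphs as rotation systems.
-- Vertices are Fin n; nb v i (i : Fin 3) is the i-th neighbour of v in
-- the clockwise rotation around v.  back v i is the index under which v
-- appears among the neighbours of nb v i (uniquely determined by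
-- simplicity).

next3 : Fin 3 → Fin 3
next3 F.zero = F.suc F.zero
next3 (F.suc F.zero) = F.suc (F.suc F.zero)
next3 (F.suc (F.suc F.zero)) = F.zero

record Cubic (n : ℕ) : Set where
  field
    nb       : Fin n → Fin 3 → Fin n
    back     : Fin n → Fin 3 → Fin 3
    nb-back  : ∀ v i → nb (nb v i) (back v i) ≡ v
    loopless : ∀ v i → nb v i ≢ v
    simple   : ∀ v i j → nb v i ≡ nb v j → i ≡ j

module _ {n : ℕ} (G : Cubic n) where
  open Cubic G

  Dart : Set
  Dart = Fin n × Fin 3

  Adj : Fin n → Fin n → Set
  Adj u v = ∃ λ i → nb u i ≡ v

  -- face permutation: follow the edge, then turn to the next dart
  φ : Dart → Dart
  φ (v , i) = nb v i , next3 (back v i)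

  iter : ℕ → Dart → Dart
  iter zero d = d
  iter (suc k) d = φ (iter k d)

  FaceLen : ℕ → Dart → Set
  FaceLen k d = iter k d ≡ d × (∀ j → 0 < j → j < k → iter j d ≢ d)

  SameFace : Dart → Dart → Set
  SameFace d e = ∃ λ j → iter j d ≡ e

  OnFace : Dart → Fin n → Set
  OnFace d v = ∃ λ j → proj₁ (iter j d) ≡ v

  data Walk (a b : Fin n) : Fin n → Fin n → Set where
    stay : ∀ {u} → Walk a b u u
    step : ∀ {u v} (i : Fin 3) → nb u i ≢ a → nb u i ≢ b →
           Walk a b (nb u i) v → Walk a b u v

  ThreeConnected : Set
  ThreeConnected = 4 ≤ n × (∀ a b u v → u ≢ a → u ≢ b → v ≢ a → v ≢ b → Walk a b u v)

  -- exactly 12 pentagonal faces: a bijection between Fin 12 and the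
  -- pentagonal faces (faces = orbits of φ)
  TwelvePentagons : Set
  TwelvePentagons = Σ (Fin 12 → Dart) λ p →
      (∀ a → FaceLen 5 (p a))
    × (∀ a b → SameFace (p a) (p b) → a ≡ b)
    × (∀ d → FaceLen 5 d → ∃ λ a → SameFace (p a) d)

  -- perfect matching: each vertex v is matched along its edge M v, and
  -- the partner is matched back along the same edge
  PerfectMatching : (Fin n → Fin 3) → Set
  PerfectMatching M = ∀ v → M (nb v (M v)) ≡ back v (M v)

  InM : (Fin n → Fin 3) → Dart → Set
  InM M (v , i) = M v ≡ i

  Alternating : (Fin n → Fin 3) → Dart → Set
  Alternating M d = ∀ j →
      (InM M (iter j d) → ¬ InM M (iter (suc j) d))
    × (¬ InM M (iter j d) → InM M (iter (suc j) d))

  Hexagon : Dart → Set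
  Hexagon d = FaceLen 6 d

  VertexDisjoint : Dart → Dart → Set
  VertexDisjoint d e = ∀ v → OnFace d v → OnFace e v → ⊥

  ResonantPattern : List Dart → Set
  ResonantPattern hs = ∃ λ M → PerfectMatching M × All (Alternating M) hs

  KResonant : ℕ → Set
  KResonant k = ∀ (hs : List Dart) → length hs ≤ k → All Hexagon hs →
                AllPairs VertexDisjoint hs → ResonantPattern hs

record Fullerene : Set where
  field
    n          : ℕ
    graph      : Cubic n
    connected3 : ThreeConnected graph
    faces56    : ∀ d → FaceLen graph 5 d ⊎ FaceLen graph 6 d
    pentagons  : TwelvePentagons graph

-- The graphs F20, F24, R5, R6.
-- Cap k (k = 5, 6) on vertices 0 .. 4k-1: outer k-cycle 0..k-1, spokes
-- i — k+i, a 2k-cycle k+i — 2k+i — k+(i+1 mod k), spokes 2k+i — 3k+i,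
-- inner k-cycle 3k .. 4k-1.  Cap 5 is the dodecahedron F20 and Cap 6 is
-- F24 (two hexagons 0..5 and 18..23, each surrounded by six pentagons).

capEdges : (k : ℕ) → List (ℕ × ℕ)
capEdges zero = Data.List.[]
capEdges k@(suc _) = concatMap edges (upTo k)
  where
  s : ℕ → ℕ
  s i = suc i % k
  edges : ℕ → List (ℕ × ℕ)
  edges i = (i , s i) Data.List.∷ (i , k + i) Data.List.∷ (k + i , 2 * k + i)
    Data.List.∷ (2 * k + i , k + s i) Data.List.∷ (2 * k + i , 3 * k + i)
    Data.List.∷ (3 * k + i , 3 * k + s i) Data.List.∷ Data.List.[]

CapAdj : ℕ → ℕ → ℕ → Set
CapAdj k u v = (u , v) ∈ capEdges k ⊎ (v , u) ∈ capEdges k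

F20Adj : Fin 20 → Fin 20 → Set
F20Adj u v = CapAdj 5 (toℕ u) (toℕ v)

F24Adj : Fin 24 → Fin 24 → Set
F24Adj u v = CapAdj 6 (toℕ u) (toℕ v)

-- R5: F20 with the vertices 0..4 of the pentagonal face deleted
R5Adj : Fin 15 → Fin 15 → Set
R5Adj u v = CapAdj 5 (5 + toℕ u) (5 + toℕ v)

-- R6: F24 with the vertices 0..5 of the hexagonal face deleted
R6Adj : Fin 18 → Fin 18 → Set
R6Adj u v = CapAdj 6 (6 + toℕ u) (6 + toℕ v)

IsomorphicTo : (F : Fullerene) (m : ℕ) → (Fin m → Fin m → Set) → Set
IsomorphicTo F m A = Σ (Fin m → Fin n) λ f → Σ (Fin n → Fin m) λ g →
    (∀ x → g (f x) ≡ x) × (∀ y → f (g y) ≡ y)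
  × (∀ u v → (A u v → Adj graph (f u) (f v)) × (Adj graph (f u) (f v) → A u v))
  where open Fullerene F

ContainsSubgraph : (F : Fullerene) (m : ℕ) → (Fin m → Fin m → Set) → Set
ContainsSubgraph F m A = Σ (Fin m → Fin n) λ f →
    (∀ x y → f x ≡ f y → x ≡ y)
  × (∀ u v → A u v → Adj graph (f u) (f v))
  where open Fullerene F

{-# OPTIONS --safe #-}
module Submission where

-- All faces have length 5 or 6, so the rotations inside R_k are forced up
-- to reflection, and the k faces around R_k meet it in paths of length two.
-- For k = 6 the central hexagon is disjoint from each of these faces, and
-- no perfect matching alternates on both it and a hexagon among them;
-- hence they are all pentagons and F is F24.  For k = 5 no perfect
-- matching alternates on two nonadjacent hexagons among these faces; hence
-- at most two of them are hexagons, those two adjacent.  Without hexagons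
-- F is F20, and otherwise at most two vertices separate F.
--
-- Each conclusion is local, so it is reached by a finite search: assume a
-- part of the rotation system, branch on where the next dart leads, and
-- stop at an impossible face, at two disjoint hexagons which no perfect
-- matching makes alternating, at a separating pair, or at Cap k.

open import Defs
open import Data.Bool using (Bool; true; false; _∧_; _∨_; not; T; T?; if_then_else_)
open import Data.Bool.ListAction using (any; all)
open import Data.Bool.Properties using (T-∧; T-∨; T-≡)
open import Data.Empty using (⊥-elim)
open import Data.Fin using (Fin; zero; suc; toℕ; fromℕ<; opposite; #_)
open import Data.Fin.Properties as Fin
  using (toℕ-injective; toℕ<n; toℕ-fromℕ<; opposite-prop; opposite-involutive)
open import Data.List
  using (List; []; _∷_; _++_; allFin; cartesianProduct; concatMap; downFrom; filter; filterᵇ;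
         fromMaybe; head; mapMaybe; upTo)
open import Data.List.Membership.DecPropositional using (_∈?_)
open import Data.List.Membership.Propositional using (_∈_; find)
open import Data.List.Membership.Propositional.Properties
  using (∈-allFin; ∈-cartesianProduct⁺; ∈-upTo⁺; ∈-upTo⁻; ∈-cartesianProduct⁻; ∈-filter⁻)
open import Data.List.Relation.Unary.All as All using (All; []; _∷_)
open import Data.List.Relation.Unary.All.Properties using (all⁺; all-filter; ++⁺)
open import Data.List.Relation.Unary.AllPairs using ([]; _∷_)
open import Data.List.Relation.Unary.Any using (here; there)
open import Data.List.Relation.Unary.Any.Properties using (any⁻)
open import Data.Maybe using (Maybe; just; nothing; maybe′; is-nothing; _>>=_)
import Data.Maybe as Maybe
open import Data.Nat using (ℕ; zero; suc; _+_; _*_; _∸_; _<_; _≡ᵇ_; _<ᵇ_; z≤n; s≤s)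
import Data.Nat as ℕ
open import Data.Nat.Properties
  using (≡ᵇ⇒≡; <ᵇ⇒<; <-irrefl; <⇒≢; ≤-refl; m<n⇒m<1+n; m<1+n⇒m<n∨m≡n; <-≤-trans; <⇒≤;
         n≤0⇒n≡0; anyUpTo?)
open import Data.Product using (∃; _×_; _,_; proj₁; proj₂)
open import Data.Product.Properties using (≡-dec)
open import Data.Sum using (_⊎_; inj₁; inj₂; [_,_]′)
open import Data.Vec as Vec using (Vec; []; _∷_; _[_]≔_)
open import Data.Vec.Properties using (lookup∘update; lookup∘update′; lookup-replicate)
open import Function using (_∘_; Equivalence)
open import Relation.Binary.Definitions using (DecidableEquality)
open import Relation.Binary.PropositionalEquality
  using (_≡_; _≢_; refl; sym; trans; cong; subst; subst₂)
open import Relation.Nullary using (¬_; Dec; yes; no; contradiction)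
open import Relation.Nullary.Decidable
  using (⌊_⌋; toWitness; toWitnessFalse; _×-dec_; _⊎-dec_; _→-dec_)

-- Partial rotation systems and the faces traced in them.

-- A dart given by the name of its tail and its position in the rotation
-- there, counted from an arbitrary reference dart of that vertex.
LDart : Set
LDart = ℕ × Fin 3

-- Row u holds the reversals of the three darts at the vertex named u, as
-- far as they are known.
Chart : Set
Chart = List (Vec (Maybe LDart) 3)

_≟_ : DecidableEquality LDart
_≟_ = ≡-dec ℕ._≟_ Fin._≟_

slots : List (Fin 3)
slots = allFin 3

darts : ℕ → List LDart
darts m = cartesianProduct (upTo m) slots

rotate : LDart → LDart
rotate (u , s) = u , next3 s

lookup : Chart → LDart → Maybe LDart
lookup []      _           = nothing
lookup (r ∷ E) (zero  , s) = Vec.lookup r s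
lookup (r ∷ E) (suc u , s) = lookup E (u , s)

insert : LDart → LDart → Chart → Chart
insert (zero  , s) y []      = (Vec.replicate 3 nothing [ s ]≔ just y) ∷ []
insert (zero  , s) y (r ∷ E) = (r [ s ]≔ just y) ∷ E
insert (suc u , s) y []      = Vec.replicate 3 nothing ∷ insert (u , s) y []
insert (suc u , s) y (r ∷ E) = r ∷ insert (u , s) y E

glue : LDart → LDart → Chart → Chart
glue x y E = insert x y (insert y x E)

trail : Chart → ∀ j → LDart → Maybe (Vec LDart (suc j))
trail E zero    x = just (x ∷ [])
trail E (suc j) x = lookup E x >>= λ y → Maybe.map (x ∷_) (trail E j (rotate y))

-- Inverse face steps: `rotate` has order three, so applying it twice undoes it. It stops early at
-- an unknown reversal.
rewind : Chart → ℕ → LDart → LDart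
rewind E zero    x = x
rewind E (suc j) x = maybe′ (rewind E j) x (lookup E (rotate (rotate x)))

irregular : Vec LDart 7 → Bool
irregular (x ∷ a ∷ b ∷ c ∷ d ∷ e ∷ f ∷ []) =
  any (λ y → ⌊ y ≟ x ⌋) (a ∷ b ∷ c ∷ d ∷ []) ∨ (not ⌊ e ≟ x ⌋ ∧ not ⌊ f ≟ x ⌋)

-- Rewinding first makes the trail run through x, so that a contradiction
-- is found as soon as seven consecutive darts around x are known.
badFace : Chart → LDart → Bool
badFace E x = maybe′ irregular false (trail E 6 (rewind E 6 x))

-- Matchings that alternate on two hexagons.

closure : Chart → LDart → List LDart
closure E x = x ∷ fromMaybe (lookup E x)

clash : List LDart → List LDart → Bool
clash xs ys = any (λ x → any (λ y → (proj₁ x ≡ᵇ proj₁ y) ∧ not ⌊ x ≟ y ⌋) ys) xs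

-- Backtracking over the matching edge at each vertex of `us`, where `A` collects the darts already
-- forced into the matching. An unknown reversal imposes no condition at its far end, so a
-- refutation is valid for every completion of the chart.
unmatchable : Chart → List ℕ → List LDart → Bool
unmatchable E []       A = false
unmatchable E (u ∷ us) A =
  all (λ s → clash (closure E (u , s)) A ∨ unmatchable E us (closure E (u , s) ++ A)) slots

unlike : Vec LDart 6 → Vec LDart 6 → Fin 6 → Fin 6 → Bool
unlike xs ys i j = not ⌊ proj₁ (Vec.lookup xs i) ℕ.≟ proj₁ (Vec.lookup ys j) ⌋

disjoint : Vec LDart 6 → Vec LDart 6 → Bool
disjoint xs ys = all (λ i → all (unlike xs ys i) (allFin 6)) (allFin 6)

alternations : Vec LDart 6 → List (List LDart)
alternations (a ∷ b ∷ c ∷ d ∷ e ∷ f ∷ []) = (a ∷ c ∷ e ∷ []) ∷ (b ∷ d ∷ f ∷ []) ∷ []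

-- In a fullerene a face whose sixth dart is not its first is a hexagon.
hexagonal : Vec LDart 6 → Bool
hexagonal xs = not ⌊ Vec.lookup xs (# 5) ≟ Vec.lookup xs (# 0) ⌋

hexagons : Chart → List LDart → List (Vec LDart 6)
hexagons E xs = filterᵇ hexagonal (mapMaybe (trail E 5) xs)

nonResonant : Chart → List ℕ → Vec LDart 6 → Vec LDart 6 → Bool
nonResonant E us xs ys = disjoint xs ys ∧
  all (λ p → all (λ q → unmatchable E us (concatMap (closure E) (p ++ q))) (alternations ys))
    (alternations xs)

-- One hexagon is always traced from a newly glued dart, which keeps the test cheap; overlooking a
-- pair is harmless for soundness.
obstructed : List ℕ → ℕ → List LDart → Chart → Bool
obstructed us m new E =
  any (λ xs → any (nonResonant E us xs) (hexagons E (darts m))) (hexagons E new)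

-- Separating pairs and recognition of Cap k.

known : (LDart → Bool) → Chart → LDart → Bool
known p E x = maybe′ p false (lookup E x)

-- If this holds, then any unnamed vertex would be cut off from the named
-- ones by the vertices named a and b, contrary to 3-connectedness.
separated : ℕ → Chart → ℕ → ℕ → Bool
separated m E a b = (a <ᵇ m) ∧ (b <ᵇ m)
  ∧ any (λ c → not ⌊ c ℕ.≟ a ⌋ ∧ not ⌊ c ℕ.≟ b ⌋) (upTo m)
  ∧ all (λ x → (proj₁ x ≡ᵇ a) ∨ (proj₁ x ≡ᵇ b) ∨ known (λ _ → true) E x) (darts m)

capAdj? : ∀ k p q → Dec (CapAdj k p q)
capAdj? k p q = (_∈?_ pair≟ (p , q) (capEdges k)) ⊎-dec (_∈?_ pair≟ (q , p) (capEdges k))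
  where
  pair≟ : DecidableEquality (ℕ × ℕ)
  pair≟ = ≡-dec ℕ._≟_ ℕ._≟_

-- The vertex p of Cap k is named 4k ∸ 1 ∸ p: the inner cycle comes first,
-- and the vertices outside R_k come last.
mirror : ℕ → ℕ → ℕ
mirror k u = 4 * k ∸ suc u

conforming : ℕ → Chart → LDart → Bool
conforming k E x = known (λ y → ⌊ capAdj? k (mirror k (proj₁ x)) (mirror k (proj₁ y)) ⌋) E x

realised : ℕ → Chart → ℕ × ℕ → Bool
realised k E (p , q) = any (λ s → known (λ y → proj₁ y ≡ᵇ mirror k q) E (mirror k p , s)) slots

-- Separation with a = b = 0 says that every vertex of F is named.
complete : ℕ → ℕ → Chart → Bool
complete k m E = (m ≡ᵇ 4 * k) ∧ separated m E 0 0
  ∧ all (conforming k E) (darts m) ∧ all (realised k E) (capEdges k)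

-- The search.

taken : Chart → LDart → LDart → Bool
taken E x y = known (λ z → not ⌊ z ≟ y ⌋) E x

link : (Chart → Bool) → Chart → LDart → LDart → Bool
link refuted E x y =
  taken E x y ∨ taken E y x ∨ (proj₁ x ≡ᵇ proj₁ y) ∨ glued (glue x y E)
  where
  glued : Chart → Bool
  glued E′ = badFace E′ x ∨ badFace E′ y ∨ refuted E′

-- The second candidate for a separating pair. If all free darts lie at the vertex of `x`, the
-- default makes both candidates equal.
second : LDart → List LDart → ℕ
second x ys = maybe′ proj₁ (proj₁ x) (head (filterᵇ (λ y → not (proj₁ y ≡ᵇ proj₁ x)) ys))

module _ (k : ℕ) where

  unglued : ℕ → Chart → List LDart
  unglued m E = filterᵇ (λ x → is-nothing (lookup E x)) (darts m)

  -- The far end of an unknown dart is either named or a new vertex; in the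
  -- latter case its reference dart is chosen to be the reversed one.
  explore : ℕ → ℕ → Chart → Bool
  branch : ℕ → ℕ → Chart → List LDart → Bool
  next : ℕ → ℕ → LDart → LDart → Chart → Bool

  -- Running out of fuel refutes nothing, so soundness does not depend on the amount of fuel.
  explore zero       m E = false
  explore (suc fuel) m E = branch fuel m E (unglued m E)

  branch fuel m E []         = complete k m E
  -- The bound holds for every list coming from `unglued`; testing it lets the soundness proof read
  -- it off.
  branch fuel m E (x ∷ free) = (proj₁ x <ᵇ m)
    ∧ all (λ y → link (next fuel m x y) E x y) (darts m)
    ∧ (separated m E (proj₁ x) (second x free)
       ∨ link (next fuel (suc m) x (m , zero)) E x (m , zero))

  -- The names below 2k are the vertices all of whose neighbours lie in R_k;
  -- it is these that cannot be matched.
  next fuel m x y E = obstructed (downFrom (2 * k)) m (x ∷ y ∷ []) E ∨ explore fuel m E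

  -- The fuel 3k is merely large enough for k = 5 and k = 6.
  place : List (Fin (3 * k) × Fin (3 * k)) → ℕ → Chart → Bool
  place []             m E = explore (3 * k) m E
  place ((j , i) ∷ es) m E = (toℕ i <ᵇ m) ∧
    ( (toℕ j <ᵇ m) ∧
        all (λ s → all (λ t → link (place es m) E (toℕ i , s) (toℕ j , t)) slots) slots
    ∨ (toℕ j ≡ᵇ m) ∧ all (λ s → link (place es (suc m)) E (toℕ i , s) (m , zero)) slots)

  RingEdge : Fin (3 * k) × Fin (3 * k) → Set
  RingEdge (j , i) = toℕ i < toℕ j × CapAdj k (k + toℕ (opposite i)) (k + toℕ (opposite j))

  ringEdge? : ∀ e → Dec (RingEdge e)
  ringEdge? (j , i) = (toℕ i ℕ.<? toℕ j) ×-dec capAdj? k _ _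

  start : List (Fin (3 * k) × Fin (3 * k)) → Bool
  start []             = false
  start ((j , i) ∷ es) =
    (toℕ i ≡ᵇ 0) ∧ (toℕ j ≡ᵇ 1) ∧ place es 2 (glue (0 , zero) (1 , zero) [])

  -- Edges are ordered by their later end `j`. Every name after 0 has an earlier neighbour, so the
  -- first edge at `j` introduces that name and the others join named vertices.
  ringEdges : List (Fin (3 * k) × Fin (3 * k))
  ringEdges = filter ringEdge? (cartesianProduct (allFin (3 * k)) (allFin (3 * k)))

  refutable : Bool
  refutable = start ringEdges

-- Booleans, lists and chart entries.

T-or : ∀ a {b} → T (a ∨ b) → T a ⊎ T b
T-or a = Equivalence.to (T-∨ {a})

T-and : ∀ a {b} → T (a ∧ b) → T a × T b
T-and a = Equivalence.to (T-∧ {a})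

all-∈ : ∀ {A : Set} (p : A → Bool) {xs x} → T (all p xs) → x ∈ xs → T (p x)
all-∈ p {xs} h = All.lookup (all⁺ p xs h)

any-∃ : ∀ {A : Set} (p : A → Bool) xs → T (any p xs) → ∃ λ x → x ∈ xs × T (p x)
any-∃ p xs = find ∘ any⁻ p xs

∈-darts : ∀ {m} x → proj₁ x < m → x ∈ darts m
∈-darts (u , s) u<m = ∈-cartesianProduct⁺ (∈-upTo⁺ u<m) (∈-allFin s)

∈-mapMaybe⁻ : ∀ {A B : Set} (f : A → Maybe B) xs {y} → y ∈ mapMaybe f xs →
              ∃ λ x → x ∈ xs × f x ≡ just y
∈-mapMaybe⁻ f (x ∷ xs) y∈ with f x in eq
... | nothing with z , z∈ , eq′ ← ∈-mapMaybe⁻ f xs y∈ = z , there z∈ , eq′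
∈-mapMaybe⁻ f (x ∷ xs) (here refl) | just _ = x , here refl , eq
∈-mapMaybe⁻ f (x ∷ xs) (there y∈)  | just _
  with z , z∈ , eq′ ← ∈-mapMaybe⁻ f xs y∈ = z , there z∈ , eq′

known-∃ : ∀ p E x → T (known p E x) → ∃ λ y → lookup E x ≡ just y × T (p y)
known-∃ p E x h with lookup E x
... | just y = y , refl , h

row-update : ∀ (r : Vec (Maybe LDart) 3) s t {y z} → Vec.lookup (r [ s ]≔ just y) t ≡ just z →
             (t ≡ s × z ≡ y) ⊎ Vec.lookup r t ≡ just z
row-update r s t eq with t Fin.≟ s
... | yes refl with refl ← trans (sym (lookup∘update s r _)) eq = inj₁ (refl , refl)
... | no t≢s = inj₂ (trans (sym (lookup∘update′ t≢s r _)) eq)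

row-empty : ∀ {A : Set} (t : Fin 3) {z : A} → Vec.lookup (Vec.replicate 3 nothing) t ≢ just z
row-empty t eq with () ← trans (sym (lookup-replicate t nothing)) eq

lookup-insert : ∀ x y E z {w} → lookup (insert x y E) z ≡ just w →
                (z ≡ x × w ≡ y) ⊎ lookup E z ≡ just w
lookup-insert (zero , s) y [] (zero , t) eq with row-update (Vec.replicate 3 nothing) s t eq
... | inj₁ (refl , refl) = inj₁ (refl , refl)
... | inj₂ eq′           = contradiction eq′ (row-empty t)
lookup-insert (zero , s) y (r ∷ E) (zero , t) eq with row-update r s t eq
... | inj₁ (refl , refl) = inj₁ (refl , refl)
... | inj₂ eq′           = inj₂ eq′
lookup-insert (zero , s) y (r ∷ E) (suc v , t) eq = inj₂ eq
lookup-insert (suc u , s) y [] (zero , t) eq = contradiction eq (row-empty t)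
lookup-insert (suc u , s) y [] (suc v , t) eq with lookup-insert (u , s) y [] (v , t) eq
... | inj₁ (refl , refl) = inj₁ (refl , refl)
... | inj₂ ()
lookup-insert (suc u , s) y (r ∷ E) (zero , t) eq = inj₂ eq
lookup-insert (suc u , s) y (r ∷ E) (suc v , t) eq with lookup-insert (u , s) y E (v , t) eq
... | inj₁ (refl , refl) = inj₁ (refl , refl)
... | inj₂ eq′           = inj₂ eq′

-- Positions counted from a reference dart.

shift : Fin 3 → Fin 3 → Fin 3
shift zero             i = i
shift (suc zero)       i = next3 i
shift (suc (suc zero)) i = next3 (next3 i)

shift-next3 : ∀ s i → shift (next3 s) i ≡ next3 (shift s i)
shift-next3 = toWitness {a? = Fin.all? λ s → Fin.all? λ i → shift (next3 s) i Fin.≟ next3 (shift s i)} _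

shift-injective : ∀ s t i → shift s i ≡ shift t i → s ≡ t
shift-injective = toWitness
  {a? = Fin.all? λ s → Fin.all? λ t → Fin.all? λ i → (shift s i Fin.≟ shift t i) →-dec (s Fin.≟ t)} _

shift-surjective : ∀ i j → ∃ λ s → shift s i ≡ j
shift-surjective = toWitness {a? = Fin.all? λ i → Fin.all? λ j → Fin.any? λ s → shift s i Fin.≟ j} _

-- Charts read in an actual graph.

module Reading {n : ℕ} (G : Cubic n) where
  open Cubic G

  rev : Dart G → Dart G
  rev (v , i) = nb v i , back v i

  -- `nb-back` returns only to the vertex; simplicity then identifies the dart.
  rev-involutive : ∀ d → rev (rev d) ≡ d
  rev-involutive (v , i) = same-head (nb-back v i) (nb-back (nb v i) (back v i))
    where
    same-head : ∀ {w j} → w ≡ v → nb w j ≡ nb v i → (w , j) ≡ (v , i)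
    same-head refl eq = cong (v ,_) (simple v _ _ eq)

  Adj-sym : ∀ {u v} → Adj G u v → Adj G v u
  Adj-sym {u} (i , refl) = back u i , nb-back u i

  -- The reference dart of each name. Values at names not yet in use are arbitrary.
  Frames : Set
  Frames = ℕ → Dart G

  vertex : Frames → ℕ → Fin n
  vertex ρ u = proj₁ (ρ u)

  dart : Frames → LDart → Dart G
  dart ρ (u , s) = vertex ρ u , shift s (proj₂ (ρ u))

  slot-of : ∀ ρ u {d} → vertex ρ u ≡ proj₁ d → ∃ λ s → dart ρ (u , s) ≡ d
  slot-of ρ u {_ , j} refl with s , eq ← shift-surjective (proj₂ (ρ u)) j = s , cong (_ ,_) eq

  -- The invariant of the search. A missing entry asserts nothing, so the chart may describe any
  -- part of `G`.
  record Charted (ρ : Frames) (m : ℕ) (E : Chart) : Set where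
    field
      apart : ∀ {u v} → u < m → v < m → vertex ρ u ≡ vertex ρ v → u ≡ v
      glued : ∀ {x y} → lookup E x ≡ just y →
              proj₁ x < m × proj₁ y < m × rev (dart ρ x) ≡ dart ρ y

    dart-injective : ∀ {x y} → proj₁ x < m → proj₁ y < m → dart ρ x ≡ dart ρ y → x ≡ y
    dart-injective {u , s} {v , t} u<m v<m eq with refl ← apart u<m v<m (cong proj₁ eq) =
      cong (u ,_) (shift-injective s t _ (cong proj₂ eq))

    φ-step : ∀ {x y} → lookup E x ≡ just y → φ G (dart ρ x) ≡ dart ρ (rotate y)
    φ-step {y = v , t} eq with _ , _ , r ← glued eq =
      trans (cong (λ (w , j) → w , next3 j) r) (cong (_ ,_) (sym (shift-next3 t _)))

  open Charted

  charted-glue : ∀ {ρ m E x y} → Charted ρ m E → proj₁ x < m → proj₁ y < m →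
                 rev (dart ρ x) ≡ dart ρ y → Charted ρ m (glue x y E)
  charted-glue {ρ} {m} {E} {x} {y} C x<m y<m r = record { apart = apart C ; glued = glued′ }
    where
    glued′ : ∀ {z w} → lookup (glue x y E) z ≡ just w →
             proj₁ z < m × proj₁ w < m × rev (dart ρ z) ≡ dart ρ w
    glued′ {z} eq with lookup-insert x y (insert y x E) z eq
    ... | inj₁ (refl , refl) = x<m , y<m , r
    ... | inj₂ eq′ with lookup-insert y x E z eq′
    ...   | inj₁ (refl , refl) = y<m , x<m , trans (cong rev (sym r)) (rev-involutive _)
    ...   | inj₂ eq″ = glued C eq″

  extend : Frames → ℕ → Dart G → Frames
  extend ρ m d u = if ⌊ u ℕ.≟ m ⌋ then d else ρ u

  extend-new : ∀ ρ m d → extend ρ m d m ≡ d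
  extend-new ρ m d with m ℕ.≟ m
  ... | yes _  = refl
  ... | no m≢m = contradiction refl m≢m

  extend-old : ∀ ρ {m} d {u} → u < m → extend ρ m d u ≡ ρ u
  extend-old ρ {m} d {u} u<m with u ℕ.≟ m
  ... | yes u≡m = contradiction u≡m (<⇒≢ u<m)
  ... | no _    = refl

  Fresh : Frames → ℕ → Fin n → Set
  Fresh ρ m v = ∀ {u} → u < m → vertex ρ u ≢ v

  dart-old : ∀ ρ {m} d x → proj₁ x < m → dart (extend ρ m d) x ≡ dart ρ x
  dart-old ρ d (u , s) u<m = cong (λ (v , i) → v , shift s i) (extend-old ρ d u<m)

  charted-extend : ∀ {ρ m E} d → Charted ρ m E → Fresh ρ m (proj₁ d) →
                   Charted (extend ρ m d) (suc m) E
  charted-extend {ρ} {m} {E} d C fresh = record { apart = apart′ ; glued = glued′ }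
    where
    old : ∀ {u} → u < m → vertex (extend ρ m d) u ≡ vertex ρ u
    old = cong proj₁ ∘ extend-old ρ d
    new : vertex (extend ρ m d) m ≡ proj₁ d
    new = cong proj₁ (extend-new ρ m d)
    apart′ : ∀ {u v} → u < suc m → v < suc m →
             vertex (extend ρ m d) u ≡ vertex (extend ρ m d) v → u ≡ v
    apart′ u< v< eq with m<1+n⇒m<n∨m≡n u< | m<1+n⇒m<n∨m≡n v<
    ... | inj₁ u<m  | inj₁ v<m  = apart C u<m v<m (trans (sym (old u<m)) (trans eq (old v<m)))
    ... | inj₁ u<m  | inj₂ refl = ⊥-elim (fresh u<m (trans (sym (old u<m)) (trans eq new)))
    ... | inj₂ refl | inj₁ v<m  = ⊥-elim (fresh v<m (trans (sym (old v<m)) (trans (sym eq) new)))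
    ... | inj₂ refl | inj₂ refl = refl
    glued′ : ∀ {x y} → lookup E x ≡ just y →
             proj₁ x < suc m × proj₁ y < suc m × rev (dart (extend ρ m d) x) ≡ dart (extend ρ m d) y
    glued′ {x} {y} eq with x<m , y<m , r ← glued C eq =
      m<n⇒m<1+n x<m , m<n⇒m<1+n y<m ,
      trans (cong rev (dart-old ρ d x x<m)) (trans r (sym (dart-old ρ d y y<m)))

  -- Faces and hexagons.

  iter-suc : ∀ j d → iter G j (φ G d) ≡ iter G (suc j) d
  iter-suc zero    d = refl
  iter-suc (suc j) d = cong (φ G) (iter-suc j d)

  record Traces (ρ : Frames) (m : ℕ) {l : ℕ} (xs : Vec LDart l) (d : Dart G) : Set where
    constructor traces
    field
      named : ∀ i → proj₁ (Vec.lookup xs i) < m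
      reads : ∀ i → dart ρ (Vec.lookup xs i) ≡ iter G (toℕ i) d

  open Traces

  trail-traces : ∀ {ρ m E} → Charted ρ m E → ∀ j x {xs} → proj₁ x < m →
                 trail E j x ≡ just xs → Traces ρ m xs (dart ρ x)
  trail-traces C zero x x<m refl = traces (λ { zero → x<m }) (λ { zero → refl })
  trail-traces {ρ} {m} {E} C (suc j) x x<m eq with lookup E x in step
  ... | just y with trail E j (rotate y) in rest
  ...   | just ys with refl ← eq =
    let _ , y<m , _ = glued C step
        T = trail-traces C j (rotate y) y<m rest
    in traces (λ { zero → x<m ; (suc i) → named T i })
              (λ { zero → refl
                 ; (suc i) → trans (reads T i)
                     (trans (cong (iter G (toℕ i)) (sym (φ-step C step))) (iter-suc (toℕ i) _)) })

  rewind-named : ∀ {ρ m E} → Charted ρ m E → ∀ j x → proj₁ x < m → proj₁ (rewind E j x) < m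
  rewind-named C zero x x<m = x<m
  rewind-named {E = E} C (suc j) x x<m with lookup E (rotate (rotate x)) in step
  ... | nothing = x<m
  ... | just y  = rewind-named C j y (proj₁ (proj₂ (glued C step)))

  -- Named darts are equal in the chart exactly when they are equal in `G`, so a trail returns to
  -- its start exactly when the face does.
  irregular-sound : ∀ {ρ m E xs d} → Charted ρ m E → Traces ρ m xs d → T (irregular xs) →
                    ¬ (FaceLen G 5 d ⊎ FaceLen G 6 d)
  irregular-sound {ρ} {m} {xs = xs@(x ∷ a ∷ b ∷ c ∷ d′ ∷ e ∷ f ∷ [])} {d} C tr irr =
    [ early , late ]′ (T-or (any (λ y → ⌊ y ≟ x ⌋) (a ∷ b ∷ c ∷ d′ ∷ [])) irr)
    where
    closes : ∀ i → iter G (toℕ i) d ≡ d → Vec.lookup xs i ≡ x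
    closes i eq = dart-injective C (named tr i) (named tr zero)
                    (trans (reads tr i) (trans eq (sym (reads tr zero))))
    returns : ∀ i → Vec.lookup xs i ≡ x → iter G (toℕ i) d ≡ d
    returns i eq = trans (sym (reads tr i)) (trans (cong (dart ρ) eq) (reads tr zero))
    minimal : ∀ i → 0 < toℕ i → toℕ i < 5 → Vec.lookup xs i ≡ x → ¬ (FaceLen G 5 d ⊎ FaceLen G 6 d)
    minimal i 0<i i<5 eq (inj₁ (_ , min)) = min (toℕ i) 0<i i<5 (returns i eq)
    minimal i 0<i i<5 eq (inj₂ (_ , min)) = min (toℕ i) 0<i (m<n⇒m<1+n i<5) (returns i eq)
    early : T (any (λ y → ⌊ y ≟ x ⌋) (a ∷ b ∷ c ∷ d′ ∷ [])) → ¬ (FaceLen G 5 d ⊎ FaceLen G 6 d)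
    early h with any⁻ (λ y → ⌊ y ≟ x ⌋) (a ∷ b ∷ c ∷ d′ ∷ []) h
    ... | here t                         = minimal (# 1) (ℕ.z<s) (toWitness {a? = 1 ℕ.<? 5} _) (toWitness t)
    ... | there (here t)                 = minimal (# 2) (ℕ.z<s) (toWitness {a? = 2 ℕ.<? 5} _) (toWitness t)
    ... | there (there (here t))         = minimal (# 3) (ℕ.z<s) (toWitness {a? = 3 ℕ.<? 5} _) (toWitness t)
    ... | there (there (there (here t))) = minimal (# 4) (ℕ.z<s) (toWitness {a? = 4 ℕ.<? 5} _) (toWitness t)
    late : T (not ⌊ e ≟ x ⌋ ∧ not ⌊ f ≟ x ⌋) → ¬ (FaceLen G 5 d ⊎ FaceLen G 6 d)
    late h with e≢x , f≢x ← T-and (not ⌊ e ≟ x ⌋) h = λ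
      { (inj₁ (eq , _)) → toWitnessFalse e≢x (closes (# 5) eq)
      ; (inj₂ (eq , _)) → toWitnessFalse f≢x (closes (# 6) eq) }

  hexagonal-sound : ∀ {ρ m E xs d} → Charted ρ m E → Traces ρ m xs d → T (hexagonal xs) →
                    FaceLen G 5 d ⊎ FaceLen G 6 d → Hexagon G d
  hexagonal-sound C tr h (inj₂ hex)      = hex
  hexagonal-sound C tr h (inj₁ (eq , _)) = contradiction
    (dart-injective C (named tr (# 5)) (named tr (# 0))
      (trans (reads tr (# 5)) (trans eq (sym (reads tr (# 0))))))
    (toWitnessFalse h)

  -- `OnFace` ranges over all iterates; periodicity leaves six to compare.
  hexagon-cycle : ∀ {d} → Hexagon G d → ∀ j → ∃ λ (i : Fin 6) → iter G j d ≡ iter G (toℕ i) d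
  hexagon-cycle hex zero = zero , refl
  hexagon-cycle hex (suc j) with hexagon-cycle hex j
  ... | zero                             , eq = # 1 , cong (φ G) eq
  ... | suc zero                         , eq = # 2 , cong (φ G) eq
  ... | suc (suc zero)                   , eq = # 3 , cong (φ G) eq
  ... | suc (suc (suc zero))             , eq = # 4 , cong (φ G) eq
  ... | suc (suc (suc (suc zero)))       , eq = # 5 , cong (φ G) eq
  ... | suc (suc (suc (suc (suc zero)))) , eq = # 0 , trans (cong (φ G) eq) (proj₁ hex)

  disjoint-sound : ∀ {ρ m E xs ys d e} → Charted ρ m E → Traces ρ m xs d → Traces ρ m ys e →
                   Hexagon G d → Hexagon G e → T (disjoint xs ys) → VertexDisjoint G d e
  disjoint-sound {xs = xs} {ys} C trx try hx hy dis v (j , refl) (l , eq)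
    with i , p ← hexagon-cycle hx j | i′ , q ← hexagon-cycle hy l =
    toWitnessFalse
      (all-∈ (unlike xs ys i)
        (all-∈ (λ i → all (unlike xs ys i) (allFin 6)) dis (∈-allFin i)) (∈-allFin i′))
      (apart C (named trx i) (named try i′)
        (trans (cong proj₁ (trans (reads trx i) (sym p)))
          (trans (sym eq) (cong proj₁ (trans q (sym (reads try i′)))))))

  -- Matchings.

  Matched : Frames → (Fin n → Fin 3) → LDart → Set
  Matched ρ M x = InM G M (dart ρ x)

  -- Whether the first dart is in `M` decides all the others.
  alternation : ∀ {ρ m xs d M} → Traces ρ m xs d → Alternating G M d →
                ∃ λ p → p ∈ alternations xs × All (Matched ρ M) p
  alternation {ρ} {xs = xs@(a ∷ b ∷ c ∷ e ∷ f ∷ g ∷ [])} {v , i} {M} tr alt with M v Fin.≟ i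
  ... | yes in0 = _ , here refl , at (# 0) in0 ∷ at (# 2) in2 ∷ at (# 4) in4 ∷ []
    where
    at : ∀ j → InM G M (iter G (toℕ j) (v , i)) → Matched ρ M (Vec.lookup xs j)
    at j = subst (InM G M) (sym (reads tr j))
    in2 : InM G M (iter G 2 (v , i))
    in2 = proj₂ (alt 1) (proj₁ (alt 0) in0)
    in4 : InM G M (iter G 4 (v , i))
    in4 = proj₂ (alt 3) (proj₁ (alt 2) in2)
  ... | no out0 = _ , there (here refl) , at (# 1) in1 ∷ at (# 3) in3 ∷ at (# 5) in5 ∷ []
    where
    at : ∀ j → InM G M (iter G (toℕ j) (v , i)) → Matched ρ M (Vec.lookup xs j)
    at j = subst (InM G M) (sym (reads tr j))
    in1 : InM G M (iter G 1 (v , i))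
    in1 = proj₂ (alt 0) out0
    in3 : InM G M (iter G 3 (v , i))
    in3 = proj₂ (alt 2) (proj₁ (alt 1) in1)
    in5 : InM G M (iter G 5 (v , i))
    in5 = proj₂ (alt 4) (proj₁ (alt 3) in3)

  module _ {M : Fin n → Fin 3} (perfect : PerfectMatching G M) where

    InM-rev : ∀ {d} → InM G M d → InM G M (rev d)
    InM-rev {v , _} refl = perfect v

    closure-matched : ∀ {ρ m E} → Charted ρ m E → ∀ x → Matched ρ M x → All (Matched ρ M) (closure E x)
    closure-matched {E = E} C x h with lookup E x in eq
    ... | nothing = h ∷ []
    ... | just y  = h ∷ subst (InM G M) (proj₂ (proj₂ (glued C eq))) (InM-rev h) ∷ []

    closures-matched : ∀ {ρ m E} → Charted ρ m E → ∀ {p} → All (Matched ρ M) p →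
                       All (Matched ρ M) (concatMap (closure E) p)
    closures-matched C []       = []
    closures-matched C (h ∷ hs) = ++⁺ (closure-matched C _ h) (closures-matched C hs)

    clash-sound : ∀ {ρ xs ys} → All (Matched ρ M) xs → All (Matched ρ M) ys → ¬ T (clash xs ys)
    clash-sound {ρ} {xs} {ys} hxs hys h
      with (u , s) , x∈xs , h′ ← any-∃ _ xs h
      with (v , t) , y∈ys , h″ ← any-∃ _ ys h′
      with u≡ᵇv , x≢y ← T-and (u ≡ᵇ v) h″
      with refl ← ≡ᵇ⇒≡ u v u≡ᵇv =
      toWitnessFalse x≢y (cong (u ,_) (shift-injective s t _
        (trans (sym (All.lookup hxs x∈xs)) (All.lookup hys y∈ys))))

    -- One of the three choices at each vertex is the one `M` makes. Following it keeps all of `A`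
    -- matched, and a clash would give some vertex two matched darts.
    unmatchable-sound : ∀ {ρ m E} → Charted ρ m E → ∀ us {A} → All (Matched ρ M) A →
                        ¬ T (unmatchable E us A)
    unmatchable-sound {ρ} {E = E} C (u ∷ us) {A} hA h
      with s , eq ← slot-of ρ u {vertex ρ u , M (vertex ρ u)} refl =
      [ clash-sound hC hA , unmatchable-sound C us (++⁺ hC hA) ]′
        (T-or (clash (closure E (u , s)) A)
          (all-∈ (λ s → clash (closure E (u , s)) A ∨ unmatchable E us (closure E (u , s) ++ A))
            h (∈-allFin s)))
      where
      hC : All (Matched ρ M) (closure E (u , s))
      hC = closure-matched C (u , s) (sym (cong proj₂ eq))

  -- Separating pairs.

  record Separated (ρ : Frames) (m : ℕ) (E : Chart) (a b : ℕ) : Set where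
    field
      a-named : a < m
      b-named : b < m
      other   : ∃ λ c → c < m × c ≢ a × c ≢ b
      rest    : ∀ {u} s → u < m → u ≢ a → u ≢ b → ∃ λ y → lookup E (u , s) ≡ just y

  separated-sound : ∀ {ρ} m E a b → T (separated m E a b) → Separated ρ m E a b
  separated-sound m E a b h
    with ha , h₁ ← T-and (a <ᵇ m) h
    with hb , h₂ ← T-and (b <ᵇ m) h₁
    with hc , hr ← T-and (any (λ c → not ⌊ c ℕ.≟ a ⌋ ∧ not ⌊ c ℕ.≟ b ⌋) (upTo m)) h₂
    with c , c∈ , hc′ ← any-∃ _ (upTo m) hc
    with c≢a , c≢b ← T-and (not ⌊ c ℕ.≟ a ⌋) hc′ = record
    { a-named = <ᵇ⇒< a m ha
    ; b-named = <ᵇ⇒< b m hb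
    ; other   = c , ∈-upTo⁻ c∈ , toWitnessFalse c≢a , toWitnessFalse c≢b
    ; rest    = rest
    }
    where
    closed : LDart → Bool
    closed x = (proj₁ x ≡ᵇ a) ∨ (proj₁ x ≡ᵇ b) ∨ known (λ _ → true) E x
    rest : ∀ {u} s → u < m → u ≢ a → u ≢ b → ∃ λ y → lookup E (u , s) ≡ just y
    rest {u} s u<m u≢a u≢b with T-or (u ≡ᵇ a) (all-∈ closed hr (∈-darts (u , s) u<m))
    ... | inj₁ u≡a = contradiction (≡ᵇ⇒≡ u a u≡a) u≢a
    ... | inj₂ h′ with T-or (u ≡ᵇ b) h′
    ...   | inj₁ u≡b = contradiction (≡ᵇ⇒≡ u b u≡b) u≢b
    ...   | inj₂ h″ with y , eq , _ ← known-∃ (λ _ → true) E (u , s) h″ = y , eq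

  -- Every dart at a named vertex other than `a` and `b` has a known reversal, hence a named far
  -- end, so a walk avoiding both never leaves the named vertices.
  walk-named : ∀ {ρ m E a b} → Charted ρ m E → Separated ρ m E a b →
               ∀ {v w} → Walk G (vertex ρ a) (vertex ρ b) v w →
               ∀ {u} → u < m → u ≢ a → u ≢ b → vertex ρ u ≡ v →
               ∃ λ u → u < m × vertex ρ u ≡ w
  walk-named C S stay u<m u≢a u≢b eq = _ , u<m , eq
  walk-named {ρ} C S (step i ≢a ≢b walk) {u} u<m u≢a u≢b refl
    with s , slot ← slot-of ρ u {_ , i} refl
    with (w , t) , eq ← Separated.rest S s u<m u≢a u≢b
    with _ , w<m , r ← glued C eq =
    walk-named C S walk w<m (≢a ∘ leads) (≢b ∘ leads) (sym tip)
    where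
    tip : nb (vertex ρ u) i ≡ vertex ρ w
    tip = cong proj₁ (trans (cong rev (sym slot)) r)
    leads : ∀ {a} → w ≡ a → nb (vertex ρ u) i ≡ vertex ρ a
    leads refl = tip

  separated-covers : ThreeConnected G → ∀ {ρ m E a b} → Charted ρ m E → Separated ρ m E a b →
                     ∀ v → v ≢ vertex ρ a → v ≢ vertex ρ b → ∃ λ u → u < m × vertex ρ u ≡ v
  separated-covers (_ , conn) {ρ} {a = a} {b} C S v v≢a v≢b
    with c , c<m , c≢a , c≢b ← Separated.other S =
    walk-named C S
      (conn (vertex ρ a) (vertex ρ b) (vertex ρ c) v
        (c≢a ∘ apart C c<m (Separated.a-named S)) (c≢b ∘ apart C c<m (Separated.b-named S)) v≢a v≢b)
      c<m c≢a c≢b refl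

  named? : ∀ ρ m v → Dec (∃ λ u → u < m × vertex ρ u ≡ v)
  named? ρ m v = anyUpTo? (λ u → vertex ρ u Fin.≟ v) m

  -- A fresh vertex differs from those named `a` and `b`, so 3-connectedness would join it to the
  -- third vertex `other` while avoiding both.
  separated-¬fresh : ThreeConnected G → ∀ {ρ m E a b} → Charted ρ m E → Separated ρ m E a b →
                     ∀ {v} → ¬ Fresh ρ m v
  separated-¬fresh conn C S fresh
    with u , u<m , eq ← separated-covers conn C S _
           (λ eq → fresh (Separated.a-named S) (sym eq)) (λ eq → fresh (Separated.b-named S) (sym eq)) =
    fresh u<m eq

-- Holds by evaluation. The matching obstruction by hand: an alternating hexagon beside `R_5`
-- matches its middle vertex on `R_5` to a boundary vertex and sends another boundary vertex
-- outward. Two disjoint ones leave at most three boundary vertices for the middle layer. The inner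
-- pentagon is matched to that layer except for pairs matched within it, so an even number of middle
-- vertices go to the boundary: exactly two, beside one inner edge. The two hexagons would then be
-- neighbours.
refutable₅ : refutable 5 ≡ true
refutable₅ = refl

-- Holds by evaluation. The matching obstruction by hand: if the central hexagon alternates, the six
-- middle vertices use up the six boundary vertices, but an alternating hexagon beside `R_6` needs
-- one of these matched outward.
refutable₆ : refutable 6 ≡ true
refutable₆ = refl

-- Soundness of the search in a 2-resonant fullerene other than Cap k.

module Refutation (F : Fullerene) (k : ℕ)
  (resonant : KResonant (Fullerene.graph F) 2)
  (notCap : ¬ IsomorphicTo F (4 * k) (λ u v → CapAdj k (toℕ u) (toℕ v)))
  where
  open Fullerene F
  open Cubic graph
  open Reading graph
  open Charted
  open Traces

  badFace-sound : ∀ {ρ m E} → Charted ρ m E → ∀ x → proj₁ x < m → ¬ T (badFace E x)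
  badFace-sound {E = E} C x x<m h with trail E 6 (rewind E 6 x) in eq
  ... | just xs =
    irregular-sound C (trail-traces C 6 _ (rewind-named C 6 x x<m) eq) h (faces56 _)

  hexagons-traced : ∀ {ρ m E} → Charted ρ m E → ∀ {xs ys} → All (λ x → proj₁ x < m) xs →
                    ys ∈ hexagons E xs → ∃ λ d → Traces ρ m ys d × Hexagon graph d
  hexagons-traced {E = E} C {xs} named ys∈
    with ys∈′ , hex ← ∈-filter⁻ (T? ∘ hexagonal) {xs = mapMaybe (trail E 5) xs} ys∈
    with x , x∈ , eq ← ∈-mapMaybe⁻ (trail E 5) xs ys∈′ =
    _ , tr , hexagonal-sound C tr hex (faces56 _)
    where tr = trail-traces C 5 x (All.lookup named x∈) eq

  nonResonant-sound : ∀ {ρ m E xs ys d e} → Charted ρ m E →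
                      Traces ρ m xs d → Traces ρ m ys e → Hexagon graph d → Hexagon graph e →
                      ∀ us → ¬ T (nonResonant E us xs ys)
  nonResonant-sound {E = E} {xs} {ys} C trx try hx hy us h =
    let dis , none = T-and (disjoint xs ys) h
        M , perfect , alternates = resonant (_ ∷ _ ∷ []) (s≤s (s≤s z≤n)) (hx ∷ hy ∷ [])
          ((disjoint-sound C trx try hx hy dis ∷ []) ∷ [] ∷ [])
        p , p∈ , hp = alternation {M = M} trx (All.head alternates)
        q , q∈ , hq = alternation {M = M} try (All.head (All.tail alternates))
    in unmatchable-sound perfect C us (closures-matched perfect C (++⁺ hp hq))
         (all-∈ (blocked p) (all-∈ (λ p → all (blocked p) (alternations ys)) none p∈) q∈)
    where
    blocked : List LDart → List LDart → Bool
    blocked p q = unmatchable E us (concatMap (closure E) (p ++ q))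

  obstructed-sound : ∀ {ρ m E} → Charted ρ m E → ∀ us {new} → All (λ x → proj₁ x < m) new →
                     ¬ T (obstructed us m new E)
  obstructed-sound {m = m} {E} C us {new} named h =
    let xs , xs∈ , h′ = any-∃ (λ xs → any (nonResonant E us xs) (hexagons E (darts m))) _ h
        ys , ys∈ , h″ = any-∃ (nonResonant E us xs) _ h′
        _ , trx , hx = hexagons-traced C {new} named xs∈
        _ , try , hy = hexagons-traced C {darts m}
          (All.tabulate (∈-upTo⁻ ∘ proj₁ ∘ ∈-cartesianProduct⁻ (upTo m) slots)) ys∈
    in nonResonant-sound C trx try hx hy us h″

  taken-sound : ∀ {ρ m E x y} → Charted ρ m E → proj₁ y < m → rev (dart ρ x) ≡ dart ρ y →
                ¬ T (taken E x y)
  taken-sound {E = E} {x} {y} C y<m r h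
    with z , eq , z≢y ← known-∃ (λ z → not ⌊ z ≟ y ⌋) E x h
    with _ , z<m , r′ ← glued C eq =
    toWitnessFalse z≢y (dart-injective C z<m y<m (trans (sym r′) r))

  -- When `G` does glue `x` to `y`, each ground for rejecting the link contradicts a property of
  -- `G`. Keeping `refuted` arbitrary serves both placing `R_k` and exploring beyond it.
  link-sound : ∀ refuted {ρ m E} x y → Charted ρ m E → proj₁ x < m → proj₁ y < m →
               rev (dart ρ x) ≡ dart ρ y →
               (Charted ρ m (glue x y E) → ¬ T (refuted (glue x y E))) →
               ¬ T (link refuted E x y)
  link-sound _ {ρ} {E = E} x y C x<m y<m r sound h with T-or (taken E x y) h
  ... | inj₁ h₁ = taken-sound C y<m r h₁
  ... | inj₂ h₁ with T-or (taken E y x) h₁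
  ... | inj₁ h₂ = taken-sound C x<m (trans (cong rev (sym r)) (rev-involutive _)) h₂
  ... | inj₂ h₂ with T-or (proj₁ x ≡ᵇ proj₁ y) h₂
  ... | inj₁ h₃ = loopless _ _ (trans (cong proj₁ r) (cong (vertex ρ) (sym (≡ᵇ⇒≡ _ _ h₃))))
  ... | inj₂ h₃ with T-or (badFace (glue x y E) x) h₃
  ... | inj₁ h₄ = badFace-sound (charted-glue C x<m y<m r) x x<m h₄
  ... | inj₂ h₄ with T-or (badFace (glue x y E) y) h₄
  ... | inj₁ h₅ = badFace-sound (charted-glue C x<m y<m r) y y<m h₅
  ... | inj₂ h₅ = sound (charted-glue C x<m y<m r) h₅

  link-fresh-sound : ∀ refuted {ρ m E} x → Charted ρ m E → proj₁ x < m →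
                     Fresh ρ m (proj₁ (rev (dart ρ x))) →
                     (Charted (extend ρ m (rev (dart ρ x))) (suc m) (glue x (m , zero) E) →
                       ¬ T (refuted (glue x (m , zero) E))) →
                     ¬ T (link refuted E x (m , zero))
  link-fresh-sound refuted {ρ} {m} x C x<m fresh =
    link-sound refuted x (m , zero) (charted-extend _ C fresh) (m<n⇒m<1+n x<m) ≤-refl
      (trans (cong rev (dart-old ρ _ x x<m)) (sym (extend-new ρ m _)))

  -- Contradicts `notCap`: connectivity makes the naming onto, `realised` carries edges of Cap k
  -- into `F`, and `conforming` carries them back.
  complete-sound : ∀ {ρ m E} → Charted ρ m E → ¬ T (complete k m E)
  complete-sound {ρ} {m} {E} C h
    with m≡4k , h₁ ← T-and (m ≡ᵇ 4 * k) h
    with refl ← ≡ᵇ⇒≡ m (4 * k) m≡4k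
    with sep , h₂ ← T-and (separated m E 0 0) h₁
    with conf , real ← T-and (all (conforming k E) (darts m)) h₂ =
    notCap (f , g , g∘f , f∘g , λ u v → forth , back′ u v)
    where
    name : Fin (4 * k) → ℕ
    name = toℕ ∘ opposite
    name<4k : ∀ u → name u < 4 * k
    name<4k = toℕ<n ∘ opposite
    mirror-name : ∀ u → mirror k (name u) ≡ toℕ u
    mirror-name u = trans (sym (opposite-prop (opposite u))) (cong toℕ (opposite-involutive u))
    f : Fin (4 * k) → Fin n
    f = vertex ρ ∘ name
    covered : ∀ v → ∃ λ u → u < 4 * k × vertex ρ u ≡ v
    covered v with named? ρ (4 * k) v
    ... | yes p = p
    ... | no ¬p = ⊥-elim (separated-¬fresh connected3 C (separated-sound (4 * k) E 0 0 sep)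
                    (λ u<m eq → ¬p (_ , u<m , eq)))
    g : Fin n → Fin (4 * k)
    g v = opposite (fromℕ< (proj₁ (proj₂ (covered v))))
    f∘g : ∀ v → f (g v) ≡ v
    f∘g v with u , u<4k , eq ← covered v =
      trans (cong (vertex ρ) (trans (cong toℕ (opposite-involutive _)) (toℕ-fromℕ< u<4k))) eq
    f-injective : ∀ {u v} → f u ≡ f v → u ≡ v
    f-injective {u} {v} eq = toℕ-injective
      (trans (sym (mirror-name u))
        (trans (cong (mirror k) (apart C (name<4k u) (name<4k v) eq)) (mirror-name v)))
    g∘f : ∀ u → g (f u) ≡ u
    g∘f u = f-injective (f∘g (f u))
    edge : ∀ {u v} → (toℕ u , toℕ v) ∈ capEdges k → Adj graph (f u) (f v)
    edge {u} {v} e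
      with s , _ , h′ ← any-∃
             (λ s → known (λ y → proj₁ y ≡ᵇ mirror k (toℕ v)) E (mirror k (toℕ u) , s)) slots
             (all-∈ (realised k E) real e)
      with y , eq , y≡ ← known-∃ (λ y → proj₁ y ≡ᵇ mirror k (toℕ v)) E _ h′
      with _ , _ , r ← glued C eq =
      subst₂ (λ a b → Adj graph (vertex ρ a) (vertex ρ b)) (sym (opposite-prop u))
        (trans (≡ᵇ⇒≡ _ _ y≡) (sym (opposite-prop v))) (_ , cong proj₁ r)
    forth : ∀ {u v} → CapAdj k (toℕ u) (toℕ v) → Adj graph (f u) (f v)
    forth (inj₁ e) = edge e
    forth (inj₂ e) = Adj-sym (edge e)
    back′ : ∀ u v → Adj graph (f u) (f v) → CapAdj k (toℕ u) (toℕ v)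
    back′ u v (i , eq)
      with s , slot ← slot-of ρ (name u) {_ , i} refl
      with y , ly , c ← known-∃
             (λ y → ⌊ capAdj? k (mirror k (name u)) (mirror k (proj₁ y)) ⌋) E (name u , s)
             (all-∈ (conforming k E) conf (∈-darts (name u , s) (name<4k u)))
      with _ , y<m , r ← glued C ly
      with refl ← apart C y<m (name<4k v) (trans (cong proj₁ (trans (sym r) (cong rev slot))) eq) =
      subst₂ (CapAdj k) (mirror-name u) (mirror-name v) (toWitness c)

  explore-sound : ∀ fuel {m E ρ} → Charted ρ m E → ¬ T (explore k fuel m E)
  branch-sound : ∀ fuel {m E ρ} → Charted ρ m E → ∀ free → ¬ T (branch k fuel m E free)
  next-sound : ∀ fuel {m x y E ρ} → Charted ρ m E → proj₁ x < m → proj₁ y < m →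
               ¬ T (next k fuel m x y E)

  explore-sound (suc fuel) {m} {E} C = branch-sound fuel C (unglued k m E)

  branch-sound fuel C [] = complete-sound C
  -- Either the far end of `x` is named and one of the links to named darts is the true one, or it
  -- is fresh, which rules out separation.
  branch-sound fuel {m} {E} {ρ} C (x ∷ free) h = cases (named? ρ m (proj₁ (rev (dart ρ x))))
    where
    x<m : proj₁ x < m
    x<m = <ᵇ⇒< _ m (proj₁ (T-and (proj₁ x <ᵇ m) h))
    joins : LDart → Bool
    joins y = link (next k fuel m x y) E x y
    h₁ : T (all joins (darts m)) × T (separated m E (proj₁ x) (second x free)
                                      ∨ link (next k fuel (suc m) x (m , zero)) E x (m , zero))
    h₁ = T-and (all joins (darts m)) (proj₂ (T-and (proj₁ x <ᵇ m) h))
    cases : ¬ Dec (∃ λ u → u < m × vertex ρ u ≡ proj₁ (rev (dart ρ x)))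
    cases (yes (u , u<m , eq)) =
      let s , slot = slot-of ρ u eq in
      link-sound (next k fuel m x (u , s)) x (u , s) C x<m u<m (sym slot)
        (λ C′ → next-sound fuel C′ x<m u<m)
        (all-∈ joins (proj₁ h₁) (∈-darts (u , s) u<m))
    cases (no ¬named) =
      [ (λ sep → separated-¬fresh connected3 C (separated-sound m E _ _ sep) fresh)
      , link-fresh-sound (next k fuel (suc m) x (m , zero)) x C x<m fresh
          (λ C′ → next-sound fuel C′ (m<n⇒m<1+n x<m) ≤-refl)
      ]′ (T-or (separated m E (proj₁ x) (second x free)) (proj₂ h₁))
      where
      fresh : Fresh ρ m (proj₁ (rev (dart ρ x)))
      fresh u<m eq = ¬named (_ , u<m , eq)

  next-sound fuel {m} {x} {y} {E} C x<m y<m h =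
    [ obstructed-sound C (downFrom (2 * k)) (x<m ∷ y<m ∷ []) , explore-sound fuel C ]′
      (T-or (obstructed (downFrom (2 * k)) m (x ∷ y ∷ []) E) h)

  -- Placing the copy of `R_k`.

  module _ (g : Fin (3 * k) → Fin n) (g-injective : ∀ {i j} → g i ≡ g j → i ≡ j)
           (g-adj : ∀ {i j} → RingEdge k (j , i) → Adj graph (g i) (g j)) where

    Covers : Frames → ℕ → Set
    Covers ρ m = ∀ i → toℕ i < m → vertex ρ (toℕ i) ≡ g i

    covers-extend : ∀ {ρ m d j} → Covers ρ m → toℕ j ≡ m → proj₁ d ≡ g j →
                    Covers (extend ρ m d) (suc m)
    covers-extend {ρ} {m} {d} {j} cov j≡m d≡ i i<1+m with m<1+n⇒m<n∨m≡n i<1+m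
    ... | inj₁ i<m = trans (cong proj₁ (extend-old ρ d i<m)) (cov i i<m)
    ... | inj₂ refl with refl ← toℕ-injective j≡m = trans (cong proj₁ (extend-new ρ m d)) d≡

    -- The names in use denote images of other vertices of `R_k`, and `g` is injective.
    covers-fresh : ∀ {ρ j} → Covers ρ (toℕ j) → Fresh ρ (toℕ j) (g j)
    covers-fresh {ρ} {j} cov {u} u<j eq =
      <-irrefl (trans (sym toℕ-u) (cong toℕ (g-injective
        (trans (sym (cov _ (subst (_< toℕ j) (sym toℕ-u) u<j))) (trans (cong (vertex ρ) toℕ-u) eq))))) u<j
      where
      toℕ-u : toℕ (fromℕ< (<-≤-trans u<j (<⇒≤ (toℕ<n j)))) ≡ u
      toℕ-u = toℕ-fromℕ< _

    place-sound : ∀ es {m E ρ} → All (RingEdge k) es → Charted ρ m E → Covers ρ m →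
                  ¬ T (place k es m E)
    place-sound [] [] C cov = explore-sound (3 * k) C
    place-sound ((j , i) ∷ es) {m} {E} {ρ} (e ∷ hes) C cov h =
      [ named-case ∘ T-and (toℕ j <ᵇ m) , fresh-case ∘ T-and (toℕ j ≡ᵇ m) ]′
        (T-or ((toℕ j <ᵇ m) ∧ all (λ s → all (old s) slots) slots) (proj₂ (T-and (toℕ i <ᵇ m) h)))
      where
      old : Fin 3 → Fin 3 → Bool
      old s t = link (place k es m) E (toℕ i , s) (toℕ j , t)
      new : Fin 3 → Bool
      new s = link (place k es (suc m)) E (toℕ i , s) (m , zero)
      i<m : toℕ i < m
      i<m = <ᵇ⇒< (toℕ i) m (proj₁ (T-and (toℕ i <ᵇ m) h))
      a : Fin 3
      -- All positions were tried; the one that matters is where the edge really leaves `g i`.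
      a = proj₁ (g-adj e)
      slot : ∃ λ s → dart ρ (toℕ i , s) ≡ (g i , a)
      slot = slot-of ρ (toℕ i) {g i , a} (cov i i<m)
      s : Fin 3
      s = proj₁ slot
      tip : proj₁ (rev (dart ρ (toℕ i , s))) ≡ g j
      tip = trans (cong (proj₁ ∘ rev) (proj₂ slot)) (proj₂ (g-adj e))
      named-case : ¬ (T (toℕ j <ᵇ m) × T (all (λ s → all (old s) slots) slots))
      named-case (j<ᵇm , h′) =
        let j<m = <ᵇ⇒< (toℕ j) m j<ᵇm
            t , eq = slot-of ρ (toℕ j) {rev (dart ρ (toℕ i , s))} (trans (cov j j<m) (sym tip))
        in link-sound (place k es m) (toℕ i , s) (toℕ j , t) C i<m j<m (sym eq)
             (λ C′ → place-sound es hes C′ cov)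
             (all-∈ (old s) (all-∈ (λ s → all (old s) slots) h′ (∈-allFin s)) (∈-allFin t))
      fresh-case : ¬ (T (toℕ j ≡ᵇ m) × T (all new slots))
      fresh-case (j≡ᵇm , h′) =
        let j≡m = ≡ᵇ⇒≡ (toℕ j) m j≡ᵇm in
        link-fresh-sound (place k es (suc m)) (toℕ i , s) C i<m
          (λ u<m eq → covers-fresh {ρ} {j} (subst (Covers ρ) (sym j≡m) cov)
                        (subst (_ <_) (sym j≡m) u<m) (trans eq tip))
          (λ C′ → place-sound es hes C′ (covers-extend {ρ} {d = rev (dart ρ (toℕ i , s))} cov j≡m tip))
          (all-∈ new h′ (∈-allFin s))

    start-sound : ∀ es → All (RingEdge k) es → ¬ T (start k es)
    start-sound ((j , i) ∷ es) (e ∷ hes) h =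
      place-sound es hes
        (charted-glue {x = 0 , zero} {1 , zero} (charted-extend d root fresh)
          (s≤s z≤n) (s≤s (s≤s z≤n)) refl)
        (covers-extend {ρ} {d = d} cov (≡ᵇ⇒≡ _ _ (proj₁ h₁)) (proj₂ (g-adj e))) (proj₂ h₁)
      where
      h₁ : T (toℕ j ≡ᵇ 1) × T (place k es 2 (glue (0 , zero) (1 , zero) []))
      h₁ = T-and (toℕ j ≡ᵇ 1) (proj₂ (T-and (toℕ i ≡ᵇ 0) h))
      a : Fin 3
      a = proj₁ (g-adj e)
      ρ : Frames
      -- A constant frame suffices, as only the name 0 is in use at first.
      ρ _ = g i , a
      d : Dart graph
      d = rev (g i , a)
      root : Charted ρ 1 []
      root = record { apart = λ { (s≤s z≤n) (s≤s z≤n) _ → refl } ; glued = λ () }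
      fresh : Fresh ρ 1 (proj₁ d)
      fresh _ eq = loopless (g i) a (sym eq)
      cov : Covers ρ 1
      cov l (s≤s l≤0) =
        cong g (toℕ-injective (trans (≡ᵇ⇒≡ _ _ (proj₁ (T-and (toℕ i ≡ᵇ 0) h))) (sym (n≤0⇒n≡0 l≤0))))

  refutation : refutable k ≡ true →
               ¬ ContainsSubgraph F (3 * k) (λ u v → CapAdj k (k + toℕ u) (k + toℕ v))
  refutation eq (f , f-injective , f-adj) =
    -- `opposite` reverses the numbering of `R_k`, so that names agree with `mirror` and start at
    -- the inner cycle.
    start-sound (f ∘ opposite)
      (λ {i} {j} e → trans (sym (opposite-involutive i))
        (trans (cong opposite (f-injective _ _ e)) (opposite-involutive j)))
      (λ (_ , e) → f-adj _ _ e)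
      (ringEdges k) (all-filter (ringEdge? k) (cartesianProduct (allFin (3 * k)) (allFin (3 * k))))
      (Equivalence.from T-≡ eq)

theorem3p4 : (F : Fullerene) →
    ¬ IsomorphicTo F 20 F20Adj → ¬ IsomorphicTo F 24 F24Adj →
    ContainsSubgraph F 15 R5Adj ⊎ ContainsSubgraph F 18 R6Adj →
    ¬ KResonant (Fullerene.graph F) 2
-- The statements about `F20Adj` and `R5Adj` are the general ones at k = 5 by computation, and
-- likewise for k = 6.
theorem3p4 F ≇F20 ≇F24 (inj₁ R5⊆F) res = Refutation.refutation F 5 res ≇F20 refutable₅ R5⊆F
theorem3p4 F ≇F20 ≇F24 (inj₂ R6⊆F) res = Refutation.refutation F 6 res ≇F24 refutable₆ R6⊆F
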